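{- The axiom system $\mathcal{S}$ consisting of (R1), (R2), (R3), (R4), (R5), (R6), (R8), (R8$'$), (R10) is equivalent to Tarski's system (R1)--(R10). That is, an algebra $\mathfrak{A}=(A,+,-,;,{}^{\smile},1')$ satisfies all axioms of $\mathcal{S}$ if and only if it satisfies all of (R1)--(R10).
   Context: All algebras have the form $\mathfrak{A}=(A,+,-,;,{}^{\smile},1')$, where $A$ is a non-empty set, $+$ and $;$ are binary operations on $A$, $-$ and ${}^{\smile}$ are unary operations on $A$, and $1'$ is a distinguished element of $A$. Unary operations bind more tightly than binary ones, and $;$ binds more tightly than $+$. An algebra satisfies an axiom if the axiom holds for all elements $r,s,t\in A$. The axioms are: (R1) $r+s=s+r$; (R2) $r+(s+t)=(r+s)+t$; (R3) $-(-r+s)+-(-r+-s)=r$; (R4) $r;(s;t)=(r;s);t$; (R5) $r;1'=r$; (R6) $(r^{\smile})^{\smile}=r$; (R7) $(r;s)^{\smile}=s^{\smile};r^{\smile}$; (R8) $(r+s);t=r;t+s;t$; (R9) $(r+s)^{\smile}=r^{\smile}+s^{\smile}$; (R10) $r^{\smile};-(r;s)+-s=-s$, i.e. $\bigl((r^{\smile});(-(r;s))\bigr)+(-s)=-s$; and the left-hand distributive law (R8$'$) $r;(s+t)=r;s+r;t$. So $\mathcal{S}$ is obtained from (R1)--(R10) by adding (R8$'$) and dropping (R7) and (R9). -}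

module Defs where

open import Level using (Level; suc; _⊔_)
open import Relation.Binary.Core using (Rel)
open import Relation.Binary.Structures using (IsEquivalence)
open import Algebra.Core using (Op₁; Op₂)
import Algebra.Definitions as AlgebraDefinitions

-- The underlying set is a setoid, as for the library's algebraic bundles, so
-- _≈_ plays the role of equality and every operation must respect it (1′ does
-- so trivially).  The carrier is non-empty because it contains 1′.
record Algebra (c ℓ : Level) : Set (suc (c ⊔ ℓ)) where
  infix  9 _˘
  infix  8 -_
  infixl 7 _⨾_
  infixl 6 _+_
  infix  4 _≈_
  field
    Carrier       : Set c
    _≈_           : Rel Carrier ℓ
    _+_           : Op₂ Carrier
    -_            : Op₁ Carrier
    _⨾_           : Op₂ Carrier
    _˘            : Op₁ Carrier
    1′            : Carrier
    isEquivalence : IsEquivalence _≈_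
    +-cong        : AlgebraDefinitions.Congruent₂ _≈_ _+_
    -‿cong        : AlgebraDefinitions.Congruent₁ _≈_ -_
    ⨾-cong        : AlgebraDefinitions.Congruent₂ _≈_ _⨾_
    ˘-cong        : AlgebraDefinitions.Congruent₁ _≈_ _˘

module _ {c ℓ : Level} (𝔄 : Algebra c ℓ) where
  open Algebra 𝔄

  R1 : Set (c ⊔ ℓ)
  R1 = ∀ r s → r + s ≈ s + r

  R2 : Set (c ⊔ ℓ)
  R2 = ∀ r s t → r + (s + t) ≈ (r + s) + t

  R3 : Set (c ⊔ ℓ)
  R3 = ∀ r s → - (- r + s) + - (- r + - s) ≈ r

  R4 : Set (c ⊔ ℓ)
  R4 = ∀ r s t → r ⨾ (s ⨾ t) ≈ (r ⨾ s) ⨾ t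

  R5 : Set (c ⊔ ℓ)
  R5 = ∀ r → r ⨾ 1′ ≈ r

  R6 : Set (c ⊔ ℓ)
  R6 = ∀ r → (r ˘) ˘ ≈ r

  R7 : Set (c ⊔ ℓ)
  R7 = ∀ r s → (r ⨾ s) ˘ ≈ s ˘ ⨾ r ˘

  R8 : Set (c ⊔ ℓ)
  R8 = ∀ r s t → (r + s) ⨾ t ≈ r ⨾ t + s ⨾ t

  R8′ : Set (c ⊔ ℓ)
  R8′ = ∀ r s t → r ⨾ (s + t) ≈ r ⨾ s + r ⨾ t

  R9 : Set (c ⊔ ℓ)
  R9 = ∀ r s → (r + s) ˘ ≈ r ˘ + s ˘

  R10 : Set (c ⊔ ℓ)
  R10 = ∀ r s → r ˘ ⨾ - (r ⨾ s) + - s ≈ - s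

  record SatisfiesTarski : Set (c ⊔ ℓ) where
    field
      r1  : R1
      r2  : R2
      r3  : R3
      r4  : R4
      r5  : R5
      r6  : R6
      r7  : R7
      r8  : R8
      r9  : R9
      r10 : R10

  record Satisfies𝒮 : Set (c ⊔ ℓ) where
    field
      r1  : R1
      r2  : R2
      r3  : R3
      r4  : R4
      r5  : R5
      r6  : R6
      r8  : R8
      r8′ : R8′
      r10 : R10

{-# OPTIONS --safe #-}
-- By Huntington's theorem (R1)–(R3) make (A , + , -) a Boolean algebra, and
-- (R6), (R8′) and (R10) then say that r ⨾_ and r ˘ ⨾_ are conjugate:
-- r ⨾ s ≤ - t iff r ˘ ⨾ t ≤ - s.  At t = 1′ this becomes r ⨾ u ≤ - 1′ iff
-- r ˘ ≤ - u, which characterises r ˘; (R7) and (R9) are obtained by checking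
-- that s ˘ ⨾ r ˘ and r ˘ + s ˘ have the characteristic property.  Conversely,
-- (R8′) is the image of (R8) under the involution ˘.
module Submission where

open import Defs
open import Level using (Level)
open import Algebra.Bundles using (CommutativeSemigroup)
open import Algebra.Definitions using (Involutive; Idempotent)
import Algebra.Lattice.Bundles as Alg
import Algebra.Lattice.Properties.Semilattice as SemilatticeProperties
import Algebra.Properties.CommutativeSemigroup as CommutativeSemigroupProperties
open import Data.Product using (_×_; _,_)
open import Data.Product.Function.NonDependent.Propositional using (_×-⇔_)
open import Function.Bundles using (_⇔_; mk⇔; module Equivalence)
open import Function.Construct.Symmetry using (⇔-sym)
open import Function.Related.Propositional using (module EquationalReasoning)
open import Relation.Binary.Bundles using (Setoid)
open import Relation.Binary.Lattice using (JoinSemilattice)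
import Relation.Binary.Reasoning.Setoid as SetoidReasoning
open import Relation.Binary.Structures using (IsEquivalence)

-- Boolean order from Huntington's axioms

module Huntington {c ℓ} (𝔄 : Algebra c ℓ) (r1 : R1 𝔄) (r2 : R2 𝔄) (r3 : R3 𝔄) where
  open Algebra 𝔄
  private module Eq = IsEquivalence isEquivalence

  +-commutativeSemigroup : CommutativeSemigroup c ℓ
  +-commutativeSemigroup = record
    { isCommutativeSemigroup = record
      { isSemigroup = record
        { isMagma = record { isEquivalence = isEquivalence ; ∙-cong = +-cong }
        ; assoc   = λ x y z → Eq.sym (r2 x y z)
        }
      ; comm = r1
      }
    }

  open CommutativeSemigroup +-commutativeSemigroup
    using (setoid; sym; trans; assoc; comm; isSemigroup)
    renaming (∙-congˡ to +-congˡ; ∙-congʳ to +-congʳ)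
  open CommutativeSemigroupProperties +-commutativeSemigroup using (interchange)
  open SetoidReasoning setoid

  -- Expanding `x` and `- x` along `- y` by `r3` gives four summands that are symmetric in `x` and
  -- `y` up to commutativity.
  +-complement-constant : ∀ x y → x + - x ≈ y + - y
  +-complement-constant x y = begin
    x + - x
      ≈⟨ +-cong (r3 x (- y)) (r3 (- x) (- y)) ⟨
    (- (- x + - y) + - (- x + - - y)) +
    (- (- - x + - y) + - (- - x + - - y))
      ≈⟨ interchange _ _ _ _ ⟩
    (- (- x + - y) + - (- - x + - y)) +
    (- (- x + - - y) + - (- - x + - - y))
      ≈⟨ +-cong (+-cong (-‿cong (comm _ _)) (-‿cong (comm _ _)))
                (+-cong (-‿cong (comm _ _)) (-‿cong (comm _ _))) ⟩
    (- (- y + - x) + - (- y + - - x)) +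
    (- (- - y + - x) + - (- - y + - - x))
      ≈⟨ +-cong (r3 y (- x)) (r3 (- y) (- x)) ⟩
    y + - y ∎

  -- Expand `- - x` along `- x` and `x` along `- - x`: one summand is in both cases the complement
  -- of the constant sum, and the other agrees up to commutativity.
  -‿involutive : Involutive _≈_ -_
  -‿involutive x = begin
    - - x
      ≈⟨ r3 (- - x) (- x) ⟨
    - (- - - x + - x) + - (- - - x + - - x)
      ≈⟨ comm _ _ ⟩
    - (- - - x + - - x) + - (- - - x + - x)
      ≈⟨ +-cong (-‿cong (trans (comm _ _) (+-complement-constant (- - x) (- x))))
                (-‿cong (comm _ _)) ⟩
    - (- x + - - x) + - (- x + - - - x)
      ≈⟨ r3 x (- - x) ⟩
    x ∎

  -- Once `⊥` is known to be neutral, `split (- x)` says that `- (- - x + - - x)` is `- x`;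
  -- complementing gives the claim.
  +-idem : Idempotent _≈_ _+_
  +-idem x = begin
    x + x                      ≈⟨ +-cong (-‿involutive x) (-‿involutive x) ⟨
    - - x + - - x              ≈⟨ -‿involutive _ ⟨
    - - (- - x + - - x)        ≈⟨ -‿cong (+-identityʳ _) ⟨
    - (- (- - x + - - x) + ⊥)  ≈⟨ -‿cong (split (- x)) ⟩
    - - x                      ≈⟨ -‿involutive x ⟩
    x                          ∎
    where
    ⊤ = x + - x
    ⊥ = - ⊤

    complement : ∀ y → y + - y ≈ ⊤
    complement y = +-complement-constant y x

    split : ∀ y → - (- y + - y) + ⊥ ≈ y
    split y = begin
      - (- y + - y) + ⊥
        ≈⟨ +-congˡ (-‿cong (complement (- y))) ⟨
      - (- y + - y) + - (- y + - - y)
        ≈⟨ r3 y (- y) ⟩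
      y ∎

    -⊥≈⊤ : - ⊥ ≈ ⊤
    -⊥≈⊤ = -‿involutive ⊤

    -- As `- ⊥` is `⊤`, `split ⊥` reads `- (⊤ + ⊤) + ⊥ ≈ ⊥`; the `⊥` it consumes comes from writing
    -- `⊤` as `⊤ + ⊥`.
    ⊤-absorbs : ⊤ + - (⊤ + ⊤) ≈ ⊤
    ⊤-absorbs = begin
      ⊤ + - (⊤ + ⊤)            ≈⟨ +-congʳ (complement ⊤) ⟨
      (⊤ + ⊥) + - (⊤ + ⊤)      ≈⟨ assoc _ _ _ ⟩
      ⊤ + (⊥ + - (⊤ + ⊤))      ≈⟨ +-congˡ (comm _ _) ⟩
      ⊤ + (- (⊤ + ⊤) + ⊥)      ≈⟨ +-congˡ (+-congʳ (-‿cong (+-cong -⊥≈⊤ -⊥≈⊤))) ⟨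
      ⊤ + (- (- ⊥ + - ⊥) + ⊥)  ≈⟨ +-congˡ (split ⊥) ⟩
      ⊤ + ⊥                    ≈⟨ complement ⊤ ⟩
      ⊤                        ∎

    ⊤+⊤≈⊤ : ⊤ + ⊤ ≈ ⊤
    ⊤+⊤≈⊤ = begin
      ⊤ + ⊤                ≈⟨ +-congˡ ⊤-absorbs ⟨
      ⊤ + (⊤ + - (⊤ + ⊤))  ≈⟨ assoc _ _ _ ⟨
      (⊤ + ⊤) + - (⊤ + ⊤)  ≈⟨ complement (⊤ + ⊤) ⟩
      ⊤                    ∎

    ⊥+⊥≈⊥ : ⊥ + ⊥ ≈ ⊥
    ⊥+⊥≈⊥ = begin
      ⊥ + ⊥              ≈⟨ +-congʳ (-‿cong ⊤+⊤≈⊤) ⟨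
      - (⊤ + ⊤) + ⊥      ≈⟨ +-congʳ (-‿cong (+-cong -⊥≈⊤ -⊥≈⊤)) ⟨
      - (- ⊥ + - ⊥) + ⊥  ≈⟨ split ⊥ ⟩
      ⊥                  ∎

    -- By `split`, every element already has `⊥` as a summand, and this absorbs a second `⊥`.
    +-identityʳ : ∀ y → y + ⊥ ≈ y
    +-identityʳ y = begin
      y + ⊥                    ≈⟨ +-congʳ (split y) ⟨
      (- (- y + - y) + ⊥) + ⊥  ≈⟨ assoc _ _ _ ⟩
      - (- y + - y) + (⊥ + ⊥)  ≈⟨ +-congˡ ⊥+⊥≈⊥ ⟩
      - (- y + - y) + ⊥        ≈⟨ split y ⟩
      y                        ∎

  +-semilattice : Alg.Semilattice c ℓ
  +-semilattice = record
    { isSemilattice = record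
      { isBand = record { isSemigroup = isSemigroup ; idem = +-idem }
      ; comm   = comm
      }
    }

  -- Here x ≤ y unfolds to y ≈ y + x.
  joinSemilattice : JoinSemilattice c ℓ ℓ
  joinSemilattice =
    SemilatticeProperties.∧-orderTheoreticJoinSemilattice +-semilattice

  open JoinSemilattice joinSemilattice
    using (_≤_; x≤x∨y; ≤-respʳ-≈; ≤-respˡ-≈)

  -- Expanding `- x` along `y` by `r3` exhibits `- y` as a summand, because `- - x + y` is `y` when
  -- `x ≤ y`.
  -‿antitone : ∀ {x y} → x ≤ y → - y ≤ - x
  -‿antitone {x} {y} x≤y = ≤-respʳ-≈ split-complement (x≤x∨y _ _)
    where
    split-complement : - y + - (- - x + - y) ≈ - x
    split-complement = begin
      - y + - (- - x + - y)
        ≈⟨ +-congʳ (-‿cong (trans x≤y (comm y x))) ⟩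
      - (x + y) + - (- - x + - y)
        ≈⟨ +-congʳ (-‿cong (+-congʳ (-‿involutive x))) ⟨
      - (- - x + y) + - (- - x + - y)
        ≈⟨ r3 (- x) y ⟩
      - x ∎

  x≤-y⇒y≤-x : ∀ {x y} → x ≤ - y → y ≤ - x
  x≤-y⇒y≤-x x≤-y = ≤-respˡ-≈ (-‿involutive _) (-‿antitone x≤-y)

-- Conjugation and the characterisation of converse

module From𝒮 {c ℓ} (𝔄 : Algebra c ℓ) (axioms : Satisfies𝒮 𝔄) where
  open Algebra 𝔄
  open Satisfies𝒮 axioms

  open Huntington 𝔄 r1 r2 r3
  open JoinSemilattice joinSemilattice
    using (_≤_; x≤x∨y; y≤x∨y; ∨-least; antisym; refl; trans; ≤-respˡ-≈; ≤-respʳ-≈; module Eq)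
  open EquationalReasoning

  ≤-congˡ-⇔ : ∀ {x y z} → x ≈ y → x ≤ z ⇔ y ≤ z
  ≤-congˡ-⇔ x≈y = mk⇔ (≤-respˡ-≈ x≈y) (≤-respˡ-≈ (Eq.sym x≈y))

  x≤-y⇔y≤-x : ∀ {x y} → x ≤ - y ⇔ y ≤ - x
  x≤-y⇔y≤-x = mk⇔ x≤-y⇒y≤-x x≤-y⇒y≤-x

  +-least-⇔ : ∀ {x y z} → x + y ≤ z ⇔ (x ≤ z × y ≤ z)
  +-least-⇔ = mk⇔ (λ le → trans (x≤x∨y _ _) le , trans (y≤x∨y _ _) le)
                  (λ (x≤z , y≤z) → ∨-least x≤z y≤z)

  ⨾-monoʳ-≤ : ∀ r {s t} → s ≤ t → r ⨾ s ≤ r ⨾ t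
  ⨾-monoʳ-≤ r {s} {t} s≤t = Eq.trans (⨾-cong Eq.refl s≤t) (r8′ r t s)

  -- Contraposition bounds `t` by `- (r ⨾ s)`; multiplying on the left by `r ˘` lands below `- s` by
  -- `r10`. Applied to `r ˘` and combined with `r6`, it also yields its own converse.
  ˘⨾-conjugate : ∀ {r s t} → r ⨾ s ≤ - t → r ˘ ⨾ t ≤ - s
  ˘⨾-conjugate {r} {s} r⨾s≤-t =
    trans (⨾-monoʳ-≤ (r ˘) (x≤-y⇒y≤-x r⨾s≤-t))
          (Eq.trans (Eq.sym (r10 r s)) (r1 _ _))

  ⨾-conjugate-⇔ : ∀ {r s t} → r ⨾ s ≤ - t ⇔ r ˘ ⨾ t ≤ - s
  ⨾-conjugate-⇔ {r} = mk⇔ ˘⨾-conjugate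
    (λ le → ≤-respˡ-≈ (⨾-cong (r6 r) Eq.refl) (˘⨾-conjugate le))

  ˘-characteristic : ∀ r {u} → r ⨾ u ≤ - 1′ ⇔ r ˘ ≤ - u
  ˘-characteristic r {u} =
    r ⨾ u ≤ - 1′    ∼⟨ ⨾-conjugate-⇔ ⟩
    r ˘ ⨾ 1′ ≤ - u  ∼⟨ ≤-congˡ-⇔ (r5 (r ˘)) ⟩
    r ˘ ≤ - u       ∎

  -- Both elements lie below the same complements, and every element is a complement.
  ˘-unique : ∀ {r x} → (∀ u → r ⨾ u ≤ - 1′ ⇔ x ≤ - u) → r ˘ ≈ x
  ˘-unique {r} {x} char = antisym
    (below λ u x≤-u → to (˘-characteristic r) (from (char u) x≤-u))
    (below λ u r˘≤-u → to (char u) (from (˘-characteristic r) r˘≤-u))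
    where
    open Equivalence using (to; from)

    below : ∀ {y z} → (∀ u → z ≤ - u → y ≤ - u) → y ≤ z
    below {z = z} le = ≤-respʳ-≈ (-‿involutive z)
      (le (- z) (≤-respʳ-≈ (Eq.sym (-‿involutive z)) refl))

  r7 : R7 𝔄
  r7 r s = ˘-unique λ u →
    (r ⨾ s) ⨾ u ≤ - 1′  ∼⟨ ≤-congˡ-⇔ (Eq.sym (r4 r s u)) ⟩
    r ⨾ (s ⨾ u) ≤ - 1′  ∼⟨ ˘-characteristic r ⟩
    -- Contraposition brings `s ⨾ u` to the left, where conjugation can move `s` across.
    r ˘ ≤ - (s ⨾ u)     ∼⟨ x≤-y⇔y≤-x ⟩
    s ⨾ u ≤ - r ˘       ∼⟨ ⨾-conjugate-⇔ ⟩
    s ˘ ⨾ r ˘ ≤ - u     ∎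

  r9 : R9 𝔄
  r9 r s = ˘-unique λ u →
    (r + s) ⨾ u ≤ - 1′             ∼⟨ ≤-congˡ-⇔ (r8 r s u) ⟩
    r ⨾ u + s ⨾ u ≤ - 1′           ∼⟨ +-least-⇔ ⟩
    (r ⨾ u ≤ - 1′ × s ⨾ u ≤ - 1′)  ∼⟨ ˘-characteristic r ×-⇔ ˘-characteristic s ⟩
    (r ˘ ≤ - u × s ˘ ≤ - u)        ∼⟨ ⇔-sym +-least-⇔ ⟩
    r ˘ + s ˘ ≤ - u                ∎

  satisfiesTarski : SatisfiesTarski 𝔄
  satisfiesTarski = record
    { r1 = r1 ; r2 = r2 ; r3 = r3 ; r4 = r4 ; r5 = r5
    ; r6 = r6 ; r7 = r7 ; r8 = r8 ; r9 = r9 ; r10 = r10 }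

-- Left distributivity by conversion

module FromTarski {c ℓ} (𝔄 : Algebra c ℓ) (axioms : SatisfiesTarski 𝔄) where
  open Algebra 𝔄
  open SatisfiesTarski axioms

  setoid : Setoid c ℓ
  setoid = record { isEquivalence = isEquivalence }

  open Setoid setoid using (refl)
  open SetoidReasoning setoid

  -- This moves the right factor to the left under a converse, so that `r8` can act on a sum there.
  ⨾-as-˘ : ∀ r s → (s ˘ ⨾ r ˘) ˘ ≈ r ⨾ s
  ⨾-as-˘ r s = begin
    (s ˘ ⨾ r ˘) ˘      ≈⟨ r7 (s ˘) (r ˘) ⟩
    (r ˘) ˘ ⨾ (s ˘) ˘  ≈⟨ ⨾-cong (r6 r) (r6 s) ⟩
    r ⨾ s              ∎

  r8′ : R8′ 𝔄
  r8′ r s t = begin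
    r ⨾ (s + t)                    ≈⟨ ⨾-as-˘ r (s + t) ⟨
    ((s + t) ˘ ⨾ r ˘) ˘            ≈⟨ ˘-cong (⨾-cong (r9 s t) refl) ⟩
    ((s ˘ + t ˘) ⨾ r ˘) ˘          ≈⟨ ˘-cong (r8 (s ˘) (t ˘) (r ˘)) ⟩
    (s ˘ ⨾ r ˘ + t ˘ ⨾ r ˘) ˘      ≈⟨ r9 _ _ ⟩
    (s ˘ ⨾ r ˘) ˘ + (t ˘ ⨾ r ˘) ˘  ≈⟨ +-cong (⨾-as-˘ r s) (⨾-as-˘ r t) ⟩
    r ⨾ s + r ⨾ t                  ∎

  satisfies𝒮 : Satisfies𝒮 𝔄
  satisfies𝒮 = record
    { r1 = r1 ; r2 = r2 ; r3 = r3 ; r4 = r4 ; r5 = r5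
    ; r6 = r6 ; r8 = r8 ; r8′ = r8′ ; r10 = r10 }

theorem4 : ∀ {c ℓ : Level} (𝔄 : Algebra c ℓ) → Satisfies𝒮 𝔄 ⇔ SatisfiesTarski 𝔄
theorem4 𝔄 = mk⇔ (From𝒮.satisfiesTarski 𝔄) (FromTarski.satisfies𝒮 𝔄)
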